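{- In terms of expressive power, $\mathsf{EMDL}\subsetneq\mathsf{EMIL}\subseteq\mathsf{EMIL}(\vee_{\mathrm{cl}})\subsetneq\mathsf{MTL}$. That is: every team property expressible in $\mathsf{EMDL}$ is expressible in $\mathsf{EMIL}$, and some team property expressible in $\mathsf{EMIL}$ is not expressible in $\mathsf{EMDL}$; every team property expressible in $\mathsf{EMIL}$ is expressible in $\mathsf{EMIL}(\vee_{\mathrm{cl}})$; every team property expressible in $\mathsf{EMIL}(\vee_{\mathrm{cl}})$ is expressible in $\mathsf{MTL}$, and some team property expressible in $\mathsf{MTL}$ is not expressible in $\mathsf{EMIL}(\vee_{\mathrm{cl}})$.
   Context: Here $\vee_{\mathrm{cl}}$ denotes classical disjunction (printed in the paper as a circled $\vee$). Fix a finite nonempty set $X$ of propositional variables. A Kripke model is $M=(W,R,\pi)$ with $W$ a nonempty set, $R\subseteq W\times W$, $\pi\colon X\to 2^W$. A team of $M$ is a set $T\subseteq W$. $\mathsf{ML}$ has syntax $\varphi ::= p\mid\neg p\mid(\varphi\wedge\varphi)\mid(\varphi\vee\varphi)\mid\Diamond\varphi\mid\Box\varphi$, $p\in X$. Team semantics, for $T\subseteq W$ (possibly empty): - $M,T\models p$ iff $T\subseteq\pi(p)$; $M,T\models\neg p$ iff $T\cap\pi(p)=\emptyset$; - $M,T\models\psi\wedge\chi$ iff $M,T\models\psi$ and $M,T\models\chi$; - $M,T\models\psi\vee\chi$ iff $T=T_1\cup T_2$ for some $T_1,T_2$ with $M,T_1\models\psi$ and $M,T_2\models\chi$; - $M,T\models\Diamond\psi$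 iff there is a team $T'$ of $M$ with $M,T'\models\psi$ such that each $w\in T$ has some $w'\in T'$ with $(w,w')\in R$ and each $w'\in T'$ has some $w\in T$ with $(w,w')\in R$; - $M,T\models\Box\psi$ iff $M,T'\models\psi$ where $T'=\{w'\in W : (w,w')\in R\text{ for some }w\in T\}$. Each logic below extends the formation rules of $\mathsf{ML}$ (so the new formulas may occur under $\wedge,\vee,\Diamond,\Box$ and any further connective of the logic), and in each of them $p,\neg p,\wedge,\vee,\Diamond,\Box$ are interpreted by the team semantics of $\mathsf{ML}$, with $\psi,\chi$ ranging over all formulas of that logic. $\mathsf{MTL}$: adds ${\sim}\psi$, with $M,T\models{\sim}\psi$ iff $M,T\not\models\psi$. For an $\mathsf{ML}$-formula $\varphi$ and world $w$ of $M$, write $\varphi(w)=1$ if $M,\{w\}\models\varphi$ and $\varphi(w)=0$ otherwise; for a set $\overline F$ of $\mathsf{ML}$-formulas write $w_1\equiv_{\overline F}w_2$ if $\varphi(w_1)=\varphi(w_2)$ for each $\varphi\in\overline F$. $\mathsf{EMDL}$: adds dependence atoms $=\!(\varphi_1,\dots,\varphi_{n-1},\varphi_n)$ for $\mathsf{ML}$-formulas $\varphi_i$, with $M,T\models{=}(\varphi_1,\dots,\varphi_n)$ iff there is a Boolean function that determines $\varphi_n(w)$ from $\varphi_1(w),\dots,\varphi_{n-1}(w)$ for all $w\in T$. $\mathsf{EMIL}$: adds independence atoms $\overline P\,\bot_{\overline R}\,\overline Q$ for finite sets $\overline P,\overline Q,\overline R$ of $\mathsf{ML}$-formulas, with $M,T\models\overline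 P\,\bot_{\overline R}\,\overline Q$ iff for all $w,w'\in T$ with $w\equiv_{\overline R}w'$ there is $w''\in T$ with $w''\equiv_{\overline P}w$, $w''\equiv_{\overline Q}w'$ and $w''\equiv_{\overline R}w$. $\mathsf{EMIL}(\vee_{\mathrm{cl}})$: extends $\mathsf{EMIL}$ by classical disjunction $\varphi\vee_{\mathrm{cl}}\psi$, with $M,T\models\varphi\vee_{\mathrm{cl}}\psi$ iff $M,T\models\varphi$ or $M,T\models\psi$. A team property is a class of pairs $(M,T)$ where $M$ is a Kripke model and $T\neq\emptyset$ is a team of $M$; it is expressible in a logic if for some formula $\varphi$ of the logic it equals the class of all $(M,T)$, $T\neq\emptyset$, with $M,T\models\varphi$. -}

module Defs where

open import Axiom.ExcludedMiddle using (ExcludedMiddle)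
open import Data.Bool.Base using (Bool)
open import Data.Empty using (⊥)
open import Data.List.Base using (List)
open import Data.List.Relation.Unary.All using (All)
open import Data.Nat.Base using (ℕ)
open import Data.Product.Base using (Σ; ∃; ∃-syntax; Σ-syntax; _×_; _,_)
open import Data.Sum.Base using (_⊎_)
open import Data.Unit.Base using (⊤)
open import Data.Vec.Base as Vec using (Vec)
open import Level using (Level; Lift; 0ℓ) renaming (suc to lsuc)
open import Relation.Binary.Core using (Rel)
open import Relation.Binary.PropositionalEquality.Core using (_≡_)
open import Relation.Nullary using (¬_; does)
open import Relation.Unary
  using (Pred; _∈_; _⊆_; _∩_; _∪_; _≐_; ｛_｝; Empty; Satisfiable)

1ℓ : Level
1ℓ = lsuc 0ℓ

record Kripke (X : Set) : Set₁ where
  field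
    W        : Set
    R        : Rel W 0ℓ
    π        : X → Pred W 0ℓ
    nonempty : W

open Kripke public

Team : ∀ {X} → Kripke X → Set₁
Team M = Pred (W M) 0ℓ

-- Satisfaction quantifies over teams, so it is valued in Set₁; this is the
-- only reason for the uses of Lift below.
TeamPred : ∀ {X} → Kripke X → Set₂
TeamPred M = Pred (Team M) 1ℓ

-- What a logic adds to ML: further atoms and further unary and binary
-- connectives, each with its team semantics.
record Logic (X : Set) : Set₂ where
  field
    Atom Unary Binary : Set
    ⟦_⟧ᵃ : Atom   → (M : Kripke X) → TeamPred M
    ⟦_⟧ᵘ : Unary  → (M : Kripke X) → TeamPred M → TeamPred M
    ⟦_⟧ᵇ : Binary → (M : Kripke X) → TeamPred M → TeamPred M → TeamPred M

open Logic public

infixr 7 _∧_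
infixr 6 _∨_

data Form {X : Set} (L : Logic X) : Set where
  var nvar : X → Form L
  _∧_ _∨_  : Form L → Form L → Form L
  ◇ □      : Form L → Form L
  atom     : Atom L → Form L
  unary    : Unary L → Form L → Form L
  binary   : Binary L → Form L → Form L → Form L

module _ {X : Set} (M : Kripke X) where

  Image : Team M → Team M
  Image T w′ = ∃[ w ] w ∈ T × R M w w′

  record Successor (T T′ : Team M) : Set where
    field
      forth : ∀ {w}  → w  ∈ T  → ∃[ w′ ] w′ ∈ T′ × R M w w′
      back  : ∀ {w′} → w′ ∈ T′ → ∃[ w  ] w  ∈ T  × R M w w′

module _ {X : Set} {L : Logic X} where

  infix 4 _,_⊨_

  _,_⊨_ : (M : Kripke X) → Team M → Form L → Set₁
  M , T ⊨ var p        = Lift 1ℓ (T ⊆ π M p)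
  M , T ⊨ nvar p       = Lift 1ℓ (Empty (T ∩ π M p))
  M , T ⊨ φ ∧ ψ        = (M , T ⊨ φ) × (M , T ⊨ ψ)
  M , T ⊨ φ ∨ ψ        = Σ[ T₁ ∈ Team M ] Σ[ T₂ ∈ Team M ]
                           T ≐ T₁ ∪ T₂ × (M , T₁ ⊨ φ) × (M , T₂ ⊨ ψ)
  M , T ⊨ ◇ φ          = Σ[ T′ ∈ Team M ] (M , T′ ⊨ φ) × Successor M T T′
  M , T ⊨ □ φ          = M , Image M T ⊨ φ
  M , T ⊨ atom a       = ⟦ L ⟧ᵃ a M T
  M , T ⊨ unary u φ    = ⟦ L ⟧ᵘ u M (λ T′ → M , T′ ⊨ φ) T
  M , T ⊨ binary b φ ψ = ⟦ L ⟧ᵇ b M (λ T′ → M , T′ ⊨ φ) (λ T′ → M , T′ ⊨ ψ) T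

ML : (X : Set) → Logic X
ML X = record
  { Atom = ⊥ ; Unary = ⊥ ; Binary = ⊥
  ; ⟦_⟧ᵃ = λ () ; ⟦_⟧ᵘ = λ () ; ⟦_⟧ᵇ = λ ()
  }

-- The unique unary connective is ∼.
MTL : (X : Set) → Logic X
MTL X = record
  { Atom = ⊥ ; Unary = ⊤ ; Binary = ⊥
  ; ⟦_⟧ᵃ = λ ()
  ; ⟦_⟧ᵘ = λ _ M P T → ¬ P T
  ; ⟦_⟧ᵇ = λ ()
  }

data DepAtom (X : Set) : Set where
  dep : ∀ {m} → Vec (Form (ML X)) m → Form (ML X) → DepAtom X

-- Finite sets of ML-formulas are given by lists of their elements.
data IndepAtom (X : Set) : Set where
  _⊥[_]_ : (P R Q : List (Form (ML X))) → IndepAtom X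

-- The truth value of a formula at a world is a Boolean only classically, hence
-- the appeal to excluded middle.
module _ (em : ExcludedMiddle 1ℓ) {X : Set} where

  value : (M : Kripke X) → Form (ML X) → W M → Bool
  value M φ w = does (em {M , ｛ w ｝ ⊨ φ})

  Agree : (M : Kripke X) → List (Form (ML X)) → Rel (W M) 0ℓ
  Agree M F w₁ w₂ = All (λ φ → value M φ w₁ ≡ value M φ w₂) F

  ⟦_⟧dep : DepAtom X → (M : Kripke X) → TeamPred M
  ⟦ dep {m} φs ψ ⟧dep M T = Lift 1ℓ (
    Σ[ f ∈ (Vec Bool m → Bool) ]
      (∀ {w} → w ∈ T → value M ψ w ≡ f (Vec.map (λ φ → value M φ w) φs)))

  ⟦_⟧indep : IndepAtom X → (M : Kripke X) → TeamPred M
  ⟦ P ⊥[ R ] Q ⟧indep M T = Lift 1ℓ (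
    ∀ {w w′} → w ∈ T → w′ ∈ T → Agree M R w w′ →
      ∃[ w″ ] w″ ∈ T × Agree M P w″ w × Agree M Q w″ w′ × Agree M R w″ w)

module _ (em : ExcludedMiddle 1ℓ) (X : Set) where

  EMDL : Logic X
  EMDL = record
    { Atom = DepAtom X ; Unary = ⊥ ; Binary = ⊥
    ; ⟦_⟧ᵃ = ⟦_⟧dep em ; ⟦_⟧ᵘ = λ () ; ⟦_⟧ᵇ = λ ()
    }

  EMIL : Logic X
  EMIL = record
    { Atom = IndepAtom X ; Unary = ⊥ ; Binary = ⊥
    ; ⟦_⟧ᵃ = ⟦_⟧indep em ; ⟦_⟧ᵘ = λ () ; ⟦_⟧ᵇ = λ ()
    }

  -- The unique binary connective beyond those of ML is classical disjunction.
  EMIL⟨∨cl⟩ : Logic X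
  EMIL⟨∨cl⟩ = record
    { Atom = IndepAtom X ; Unary = ⊥ ; Binary = ⊤
    ; ⟦_⟧ᵃ = ⟦_⟧indep em
    ; ⟦_⟧ᵘ = λ ()
    ; ⟦_⟧ᵇ = λ _ M P Q T → P T ⊎ Q T
    }

record TeamModel (X : Set) : Set₁ where
  field
    model         : Kripke X
    team          : Team model
    team-nonempty : Satisfiable team

open TeamModel public

TeamProperty : Set → Set₂
TeamProperty X = Pred (TeamModel X) 1ℓ

module _ {X : Set} where

  Defines : {L : Logic X} → Form L → TeamProperty X
  Defines φ K = model K , team K ⊨ φ

  Expressible : Logic X → TeamProperty X → Set₁
  Expressible L P = Σ[ φ ∈ Form L ] P ≐ Defines φ

  infix 4 _≼_ _≺_

  _≼_ : Logic X → Logic X → Set₂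
  L₁ ≼ L₂ = ∀ (P : TeamProperty X) → Expressible L₁ P → Expressible L₂ P

  _≺_ : Logic X → Logic X → Set₂
  L₁ ≺ L₂ = L₁ ≼ L₂ ×
            (Σ[ P ∈ TeamProperty X ] Expressible L₂ P × ¬ Expressible L₁ P)

{-# OPTIONS --safe #-}
-- The inclusions come from compositional translations.  A dependence atom
-- =(φ̄ , ψ) says that ψ is independent of itself given φ̄.  An independence atom
-- says that, whenever the P̄-type a and the R̄-type c are jointly realised in the
-- team and so are b and c, then a, b and c are jointly realised; there are
-- finitely many types, ML is flat and closed under negation at worlds, so MTL
-- expresses this.
--
-- For the separations: EMDL is downward closed while p ⊥ ◇p is not; and over a
-- frame without edges, satisfaction of an EMIL(∨cl) formula is inherited by all
-- subteams with at most one world, while ∼¬p ("some world satisfies p") is not.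
module Submission where

open import Defs
open import Axiom.ExcludedMiddle using (ExcludedMiddle)
open import Data.Bool.Base using (Bool; true; false)
open import Data.Bool.Properties using (¬-not)
open import Data.Empty using (⊥)
open import Data.Fin.Base using (Fin; zero)
open import Data.List.Base using (List; []; _∷_; length)
import Data.List.Relation.Unary.All as All
open All using ([]; _∷_)
open import Data.Nat.Base using (ℕ; zero; suc)
open import Data.Product.Base using (∃-syntax; _×_; _,_; proj₁; proj₂)
open import Data.Sum.Base as Sum using (_⊎_; inj₁; inj₂; [_,_]′)
open import Data.Unit.Base using (⊤; tt)
open import Data.Vec.Base as Vec using (Vec; []; _∷_; fromList; toList)
open import Data.Vec.Properties using (∷-injective; toList∘fromList)
open import Function.Base using (id; _∘_)
open import Function.Bundles using (_↔_; _⇔_; mk⇔; Equivalence; Inverse)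
open import Function.Construct.Identity using (⇔-id)
open import Level using (0ℓ; lift; lower)
open import Relation.Binary.PropositionalEquality.Core
  using (_≡_; refl; sym; trans; cong; cong₂; subst)
open import Relation.Nullary using (¬_; Dec; yes; no; does; contradiction)
open import Relation.Nullary.Decidable using (map′; decidable-stable)
open import Relation.Unary using (_∈_; _⊆_; _∩_; ｛_｝; U)

open Equivalence using (to; from)
open Successor

-- Compositional translations between logics.

module _ {X : Set} where

  -- Only what a logic adds to ML has to be interpreted. The connective clauses take any `P`
  -- equivalent to `φ` on all teams, since a subformula and its translation have equivalent, not
  -- equal, team predicates.
  record Interpretation (L₁ L₂ : Logic X) : Set₂ where
    field
      atom↦   : Atom L₁ → Form L₂
      unary↦  : Unary L₁ → Form L₂ → Form L₂
      binary↦ : Binary L₁ → Form L₂ → Form L₂ → Form L₂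
      atom-⇔  : ∀ a M T → ⟦ L₁ ⟧ᵃ a M T ⇔ (M , T ⊨ atom↦ a)
      unary-⇔ : ∀ u {M P φ} → (∀ T → P T ⇔ (M , T ⊨ φ)) →
                ∀ T → ⟦ L₁ ⟧ᵘ u M P T ⇔ (M , T ⊨ unary↦ u φ)
      binary-⇔ : ∀ b {M P Q φ ψ} →
                 (∀ T → P T ⇔ (M , T ⊨ φ)) → (∀ T → Q T ⇔ (M , T ⊨ ψ)) →
                 ∀ T → ⟦ L₁ ⟧ᵇ b M P Q T ⇔ (M , T ⊨ binary↦ b φ ψ)

  module _ {L₁ L₂ : Logic X} (I : Interpretation L₁ L₂) where

    open Interpretation I

    translate : Form L₁ → Form L₂
    translate (var p)        = var p
    translate (nvar p)       = nvar p
    translate (φ ∧ ψ)        = translate φ ∧ translate ψ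
    translate (φ ∨ ψ)        = translate φ ∨ translate ψ
    translate (◇ φ)          = ◇ (translate φ)
    translate (□ φ)          = □ (translate φ)
    translate (atom a)       = atom↦ a
    translate (unary u φ)    = unary↦ u (translate φ)
    translate (binary b φ ψ) = binary↦ b (translate φ) (translate ψ)

    translate-⇔ : ∀ {M} φ T → (M , T ⊨ φ) ⇔ (M , T ⊨ translate φ)
    translate-⇔ (var p)  T = ⇔-id _
    translate-⇔ (nvar p) T = ⇔-id _
    translate-⇔ (φ ∧ ψ) T = mk⇔
      (λ (s , t) → to (translate-⇔ φ T) s , to (translate-⇔ ψ T) t)
      (λ (s , t) → from (translate-⇔ φ T) s , from (translate-⇔ ψ T) t)
    translate-⇔ (φ ∨ ψ) T = mk⇔
      (λ (T₁ , T₂ , eq , s , t) →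
        T₁ , T₂ , eq , to (translate-⇔ φ T₁) s , to (translate-⇔ ψ T₂) t)
      (λ (T₁ , T₂ , eq , s , t) →
        T₁ , T₂ , eq , from (translate-⇔ φ T₁) s , from (translate-⇔ ψ T₂) t)
    translate-⇔ (◇ φ) T = mk⇔
      (λ (T′ , s , R) → T′ , to (translate-⇔ φ T′) s , R)
      (λ (T′ , s , R) → T′ , from (translate-⇔ φ T′) s , R)
    translate-⇔ {M} (□ φ) T = translate-⇔ φ (Image M T)
    translate-⇔ {M} (atom a) T = atom-⇔ a M T
    translate-⇔ (unary u φ) T = unary-⇔ u (translate-⇔ φ) T
    translate-⇔ (binary b φ ψ) T = binary-⇔ b (translate-⇔ φ) (translate-⇔ ψ) T

    interpretation⇒≼ : L₁ ≼ L₂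
    interpretation⇒≼ P (φ , P⊆φ , φ⊆P) =
      translate φ ,
      (λ {K} s → to (translate-⇔ φ (team K)) (P⊆φ s)) ,
      (λ {K} s → φ⊆P (from (translate-⇔ φ (team K)) s))

  -- Inheritance of satisfaction by restricted subteams.

  module _ (M : Kripke X) (C : Team M → Set) where

    -- The condition `C` falls on the subteam only. With `C` always true this is downward closure; a
    -- stronger `C` can admit atoms that are not downward closed.
    RestrictsTo : TeamPred M → Set₁
    RestrictsTo P = ∀ {S T} → C S → S ⊆ T → P T → P S

    module _ {L : Logic X}
      (C-⊆ : ∀ {S T} → S ⊆ T → C T → C S)
      (C-image : ∀ {T} → C T → C (Image M T))
      (atom-restricts : ∀ a → RestrictsTo (⟦ L ⟧ᵃ a M))
      (unary-restricts : ∀ u {P} → RestrictsTo P → RestrictsTo (⟦ L ⟧ᵘ u M P))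
      (binary-restricts : ∀ b {P Q} → RestrictsTo P → RestrictsTo Q →
                          RestrictsTo (⟦ L ⟧ᵇ b M P Q))
      where

      ⊨-restricts : ∀ φ → RestrictsTo (λ T → _,_⊨_ {L = L} M T φ)
      ⊨-restricts (var p) c S⊆T (lift s) = lift (λ w∈S → s (S⊆T w∈S))
      ⊨-restricts (nvar p) c S⊆T (lift s) =
        lift (λ w (w∈S , w∈p) → s w (S⊆T w∈S , w∈p))
      ⊨-restricts (φ ∧ ψ) c S⊆T (s , t) =
        ⊨-restricts φ c S⊆T s , ⊨-restricts ψ c S⊆T t
      ⊨-restricts (φ ∨ ψ) {S} c S⊆T (T₁ , T₂ , (T⊆∪ , _) , s , t) =
        S ∩ T₁ , S ∩ T₂ ,
        ((λ w∈S → Sum.map (w∈S ,_) (w∈S ,_) (T⊆∪ (S⊆T w∈S))) ,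
         [ proj₁ , proj₁ ]′) ,
        ⊨-restricts φ (C-⊆ proj₁ c) proj₂ s ,
        ⊨-restricts ψ (C-⊆ proj₁ c) proj₂ t
      ⊨-restricts (◇ φ) {S} c S⊆T (T′ , s , succ) =
        -- Cutting `T′` down to the successors of `S` makes `back` immediate and keeps every
        -- successor that `forth` needs.
        Image M S ∩ T′ ,
        ⊨-restricts φ (C-⊆ proj₁ (C-image c)) proj₂ s ,
        record
          { forth = λ {w} w∈S →
              let w′ , w′∈T′ , wRw′ = forth succ (S⊆T w∈S)
              in  w′ , ((w , w∈S , wRw′) , w′∈T′) , wRw′
          ; back = proj₁
          }
      ⊨-restricts (□ φ) c S⊆T s =
        ⊨-restricts φ (C-image c) (λ (w , w∈S , wRw′) → w , S⊆T w∈S , wRw′) s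
      ⊨-restricts (atom a) = atom-restricts a
      ⊨-restricts (unary u φ) = unary-restricts u (⊨-restricts φ)
      ⊨-restricts (binary b φ ψ) =
        binary-restricts b (⊨-restricts φ) (⊨-restricts ψ)

  -- Flatness of ML and negation at worlds.

  Sat : (M : Kripke X) → Form (ML X) → W M → Set
  Sat M (var p)  w = π M p w
  Sat M (nvar p) w = ¬ π M p w
  Sat M (φ ∧ ψ)  w = Sat M φ w × Sat M ψ w
  Sat M (φ ∨ ψ)  w = Sat M φ w ⊎ Sat M ψ w
  Sat M (◇ φ)    w = ∃[ w′ ] R M w w′ × Sat M φ w′
  Sat M (□ φ)    w = ∀ {w′} → R M w w′ → Sat M φ w′

  -- From right to left the largest candidates work: both halves of a split, and the successor team
  -- of `◇`, consist of all eligible worlds that satisfy the subformula. `Sat M φ` is valued in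
  -- `Set`, so it is itself a team and can be used to form them.
  flat : ∀ M φ T → (M , T ⊨ φ) ⇔ (T ⊆ Sat M φ)
  flat M (var p) T = mk⇔ lower lift
  flat M (nvar p) T = mk⇔
    (λ (lift s) {w} w∈T w∈p → s w (w∈T , w∈p))
    (λ s → lift (λ w (w∈T , w∈p) → s w∈T w∈p))
  flat M (φ ∧ ψ) T = mk⇔
    (λ (s , t) {w} w∈T → to (flat M φ T) s w∈T , to (flat M ψ T) t w∈T)
    (λ s → from (flat M φ T) (λ w∈T → proj₁ (s w∈T)) ,
           from (flat M ψ T) (λ w∈T → proj₂ (s w∈T)))
  flat M (φ ∨ ψ) T = mk⇔
    (λ (T₁ , T₂ , (T⊆∪ , _) , s , t) {w} w∈T →
      Sum.map (to (flat M φ T₁) s) (to (flat M ψ T₂) t) (T⊆∪ w∈T))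
    (λ s → T ∩ Sat M φ , T ∩ Sat M ψ ,
      ((λ {w} w∈T → Sum.map (w∈T ,_) (w∈T ,_) (s w∈T)) , λ {w} → [ proj₁ , proj₁ ]′) ,
      from (flat M φ _) proj₂ , from (flat M ψ _) proj₂)
  flat M (◇ φ) T = mk⇔
    (λ (T′ , s , succ) {w} w∈T →
      let w′ , w′∈T′ , wRw′ = forth succ w∈T in w′ , wRw′ , to (flat M φ T′) s w′∈T′)
    (λ (s : T ⊆ Sat M (◇ φ)) → Image M T ∩ Sat M φ , from (flat M φ _) proj₂ , record
      { forth = λ {w} w∈T →
          let w′ , wRw′ , t = s w∈T in w′ , ((w , w∈T , wRw′) , t) , wRw′
      ; back = proj₁
      })
  flat M (□ φ) T = mk⇔
    (λ s {w} w∈T {w′} wRw′ → to (flat M φ (Image M T)) s (w , w∈T , wRw′))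
    (λ s → from (flat M φ (Image M T)) (λ (w , w∈T , wRw′) → s w∈T wRw′))

  singleton-⇔ : ∀ {M} φ w → (M , ｛ w ｝ ⊨ φ) ⇔ Sat M φ w
  singleton-⇔ {M} φ w = mk⇔
    (λ s → to (flat M φ _) s refl)
    (λ s → from (flat M φ _) (λ { refl → s }))

  -- ML negates variables only, so negation is pushed inwards by duality. It complements `φ` at
  -- worlds; on teams it differs from `∼`: the empty team satisfies both `φ` and `neg φ`.
  neg : Form (ML X) → Form (ML X)
  neg (var p)  = nvar p
  neg (nvar p) = var p
  neg (φ ∧ ψ)  = neg φ ∨ neg ψ
  neg (φ ∨ ψ)  = neg φ ∧ neg ψ
  neg (◇ φ)    = □ (neg φ)
  neg (□ φ)    = ◇ (neg φ)

  -- Existence, implication and types as formulas.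

  ML→MTL : Interpretation (ML X) (MTL X)
  ML→MTL = record
    { atom↦ = λ () ; unary↦ = λ () ; binary↦ = λ ()
    ; atom-⇔ = λ () ; unary-⇔ = λ () ; binary-⇔ = λ () }

  ∼_ : Form (MTL X) → Form (MTL X)
  ∼_ = unary tt

  -- By flatness `neg φ` holds on a team exactly when no world of it satisfies `φ`; `∼` turns this
  -- into existence.
  somewhere : Form (ML X) → Form (MTL X)
  somewhere φ = ∼ translate ML→MTL (neg φ)

  infixr 5 _⇒_

  -- Team disjunction `∨` splits the team, so the Boolean implication between properties of one team
  -- is built from `∼` and `∧`.
  _⇒_ : Form (MTL X) → Form (MTL X) → Form (MTL X)
  φ ⇒ ψ = ∼ (φ ∧ ∼ ψ)

  ⋀ : ∀ {n} → (Vec Bool n → Form (MTL X)) → Form (MTL X)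
  ⋀ {zero}  φ = φ []
  ⋀ {suc n} φ = ⋀ (λ v → φ (true ∷ v)) ∧ ⋀ (λ v → φ (false ∷ v))

  ⋀-⇔ : ∀ {n M T} (φ : Vec Bool n → Form (MTL X)) →
        (M , T ⊨ ⋀ φ) ⇔ (∀ v → M , T ⊨ φ v)
  ⋀-⇔ {zero} φ = mk⇔ (λ { s [] → s }) (λ s → s [])
  ⋀-⇔ {suc n} φ = mk⇔
    (λ { (s , t) (true  ∷ v) → to (⋀-⇔ _) s v
       ; (s , t) (false ∷ v) → to (⋀-⇔ _) t v })
    (λ s → from (⋀-⇔ _) (λ v → s (true ∷ v)) , from (⋀-⇔ _) (λ v → s (false ∷ v)))

  literal : Bool → Form (ML X) → Form (ML X)
  literal true  φ = φ
  literal false φ = neg φ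

  -- The variable is only needed to write down a tautology.
  hasType : X → ∀ {n} → Vec (Form (ML X)) n → Vec Bool n → Form (ML X)
  hasType x []       []      = var x ∨ nvar x
  hasType x (φ ∷ φs) (b ∷ v) = literal b φ ∧ hasType x φs v

-- Truth values and types of worlds under classical logic.

module _ (em : ExcludedMiddle 1ℓ) {X : Set} where

  em₀ : ExcludedMiddle 0ℓ
  em₀ = map′ lower lift em

  neg-⇔ : ∀ {M : Kripke X} φ w → Sat M (neg φ) w ⇔ (¬ Sat M φ w)
  neg-⇔ (var p) w = ⇔-id _
  neg-⇔ (nvar p) w = mk⇔ (λ s t → t s) (decidable-stable em₀)
  neg-⇔ (φ ∧ ψ) w = mk⇔
    (λ { (inj₁ s) (t , _) → to (neg-⇔ φ w) s t
       ; (inj₂ s) (_ , t) → to (neg-⇔ ψ w) s t })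
    deMorgan
    where
    deMorgan : ¬ Sat _ (φ ∧ ψ) w → Sat _ (neg (φ ∧ ψ)) w
    deMorgan s with em₀
    ... | yes t = inj₂ (from (neg-⇔ ψ w) (λ u → s (t , u)))
    ... | no ¬t = inj₁ (from (neg-⇔ φ w) ¬t)
  neg-⇔ (φ ∨ ψ) w = mk⇔
    (λ (s , t) → [ to (neg-⇔ φ w) s , to (neg-⇔ ψ w) t ]′)
    (λ s → from (neg-⇔ φ w) (s ∘ inj₁) , from (neg-⇔ ψ w) (s ∘ inj₂))
  neg-⇔ (◇ φ) w = mk⇔
    (λ s (w′ , wRw′ , t) → to (neg-⇔ φ w′) (s wRw′) t)
    (λ s {w′} wRw′ → from (neg-⇔ φ w′) (λ t → s (w′ , wRw′ , t)))
  neg-⇔ (□ φ) w = mk⇔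
    (λ (w′ , wRw′ , s) t → to (neg-⇔ φ w′) s (t wRw′))
    (λ s → decidable-stable em₀ (λ n → s (λ {w′} wRw′ →
      decidable-stable em₀ (λ ¬t → n (w′ , wRw′ , from (neg-⇔ φ w′) ¬t)))))

  value-⇔ : ∀ {M : Kripke X} φ w b → value em M φ w ≡ b ⇔ Sat M (literal b φ) w
  value-⇔ {M} φ w b with em {M , ｛ w ｝ ⊨ φ}
  value-⇔ φ w true  | yes s = mk⇔ (λ _ → to (singleton-⇔ φ w) s) (λ _ → refl)
  value-⇔ φ w false | yes s = mk⇔ (λ ())
    (λ t → contradiction (to (singleton-⇔ φ w) s) (to (neg-⇔ φ w) t))
  value-⇔ φ w true  | no ¬s = mk⇔ (λ ())
    (λ t → contradiction (from (singleton-⇔ φ w) t) ¬s)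
  value-⇔ φ w false | no ¬s = mk⇔
    (λ _ → from (neg-⇔ φ w) (¬s ∘ from (singleton-⇔ φ w))) (λ _ → refl)

  typeOf : ∀ {n} (M : Kripke X) → Vec (Form (ML X)) n → W M → Vec Bool n
  typeOf M φs w = Vec.map (λ φ → value em M φ w) φs

  -- Agreement becomes equality of Boolean vectors, a finite range over which `⋀` can run.
  Agree-⇔ : ∀ {n M} (φs : Vec (Form (ML X)) n) {w w′} →
            Agree em M (toList φs) w w′ ⇔ typeOf M φs w ≡ typeOf M φs w′
  Agree-⇔ []       = mk⇔ (λ _ → refl) (λ _ → [])
  Agree-⇔ (φ ∷ φs) = mk⇔
    (λ { (e ∷ es) → cong₂ _∷_ e (to (Agree-⇔ φs) es) })
    (λ e → let e₁ , e₂ = ∷-injective e in e₁ ∷ from (Agree-⇔ φs) e₂)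

  Agree-fromList : ∀ {M : Kripke X} F {w w′} →
    Agree em M F w w′ ⇔ typeOf M (fromList F) w ≡ typeOf M (fromList F) w′
  Agree-fromList {M} F {w} {w′} = subst
    (λ G → Agree em M G w w′ ⇔ typeOf M (fromList F) w ≡ typeOf M (fromList F) w′)
    (toList∘fromList F) (Agree-⇔ (fromList F))

  hasType-⇔ : ∀ x {n M} (φs : Vec (Form (ML X)) n) v w →
              Sat M (hasType x φs v) w ⇔ typeOf M φs w ≡ v
  hasType-⇔ x {M = M} [] [] w = mk⇔ (λ _ → refl) (λ _ → tautology)
    where
    tautology : Sat M (var x ∨ nvar x) w
    tautology with em₀
    ... | yes s = inj₁ s
    ... | no ¬s = inj₂ ¬s
  hasType-⇔ x (φ ∷ φs) (b ∷ v) w = mk⇔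
    (λ (s , t) → cong₂ _∷_ (from (value-⇔ φ w b) s) (to (hasType-⇔ x φs v w) t))
    (λ e → let e₁ , e₂ = ∷-injective e in
      to (value-⇔ φ w b) e₁ , from (hasType-⇔ x φs v w) e₂)

  Somewhere : (M : Kripke X) → Team M → Form (ML X) → Set
  Somewhere M T φ = ∃[ w ] w ∈ T × Sat M φ w

  somewhere-⇔ : ∀ {M T} φ → (M , T ⊨ somewhere φ) ⇔ Somewhere M T φ
  somewhere-⇔ {M} {T} φ = mk⇔
    (λ s → decidable-stable em₀ (λ n → s (to (translate-⇔ ML→MTL (neg φ) T)
      (from (flat M (neg φ) T)
        (λ {w} w∈T → from (neg-⇔ φ w) (λ t → n (w , w∈T , t)))))))
    (λ (w , w∈T , s) t → to (neg-⇔ φ w)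
      (to (flat M (neg φ) T) (from (translate-⇔ ML→MTL (neg φ) T) t) w∈T) s)

  ⇒-⇔ : ∀ {M : Kripke X} {T} φ ψ →
        (M , T ⊨ φ ⇒ ψ) ⇔ ((M , T ⊨ φ) → (M , T ⊨ ψ))
  ⇒-⇔ φ ψ = mk⇔
    (λ s t → decidable-stable em (λ n → s (t , n)))
    (λ s (t , n) → n (s t))

  somewhere-⇒-⇔ : ∀ {M T} φ ψ χ →
    (M , T ⊨ somewhere φ ⇒ somewhere ψ ⇒ somewhere χ) ⇔
    (Somewhere M T φ → Somewhere M T ψ → Somewhere M T χ)
  somewhere-⇒-⇔ φ ψ χ = mk⇔
    (λ r s t → to (somewhere-⇔ χ)
      (to (⇒-⇔ (somewhere ψ) (somewhere χ))
        (to (⇒-⇔ (somewhere φ) (somewhere ψ ⇒ somewhere χ)) r (from (somewhere-⇔ φ) s))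
        (from (somewhere-⇔ ψ) t)))
    (λ r → from (⇒-⇔ (somewhere φ) (somewhere ψ ⇒ somewhere χ)) λ s →
           from (⇒-⇔ (somewhere ψ) (somewhere χ)) λ t →
           from (somewhere-⇔ χ) (r (to (somewhere-⇔ φ) s) (to (somewhere-⇔ ψ) t)))

  -- Dependence atoms as independence atoms.

  dep↦indep : DepAtom X → IndepAtom X
  dep↦indep (dep φs ψ) = (ψ ∷ []) ⊥[ toList φs ] (ψ ∷ [])

  -- Forward, `w` is its own witness. Backward, the value of `ψ` at the witness `w″` equals its
  -- values at both `w` and `w′`, so worlds of `T` with equal types agree on `ψ`.
  dep-⇔ : ∀ a M T → ⟦ em ⟧dep a M T ⇔ ⟦ em ⟧indep (dep↦indep a) M T
  dep-⇔ (dep {m} φs ψ) M T = mk⇔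
    (λ (lift (f , determines)) → lift (λ {w} w∈T w′∈T w~w′ →
      w , w∈T , refl ∷ [] ,
      trans (determines w∈T)
        (trans (cong f (to (Agree-⇔ φs) w~w′)) (sym (determines w′∈T))) ∷ [] ,
      from (Agree-⇔ φs) refl))
    (λ (lift indep) → lift (f , determines indep))
    where
    True : Vec Bool m → Set
    True v = ∃[ w ] w ∈ T × typeOf M φs w ≡ v × value em M ψ w ≡ true

    -- Types not realised in `T` get the default value `false`.
    f : Vec Bool m → Bool
    f v = does (em₀ {True v})

    determines : (∀ {w w′} → w ∈ T → w′ ∈ T → Agree em M (toList φs) w w′ →
                   ∃[ w″ ] w″ ∈ T × Agree em M (ψ ∷ []) w″ w ×
                     Agree em M (ψ ∷ []) w″ w′ × Agree em M (toList φs) w″ w) →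
                 ∀ {w} → w ∈ T → value em M ψ w ≡ f (typeOf M φs w)
    determines indep {w} w∈T = value≡does em₀
      where
      value≡does : (true? : Dec (True (typeOf M φs w))) →
                   value em M ψ w ≡ does true?
      value≡does (no ¬true) = ¬-not (λ e → ¬true (w , w∈T , refl , e))
      value≡does (yes (w′ , w′∈T , w′~w , ψw′))
        with indep w′∈T w∈T (from (Agree-⇔ φs) w′~w)
      ... | _ , _ , e ∷ [] , e′ ∷ [] , _ = trans (sym e′) (trans e ψw′)

  EMDL→EMIL : Interpretation (EMDL em X) (EMIL em X)
  EMDL→EMIL = record
    { atom↦ = λ a → atom (dep↦indep a) ; unary↦ = λ () ; binary↦ = λ ()
    ; atom-⇔ = dep-⇔ ; unary-⇔ = λ () ; binary-⇔ = λ () }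

  EMIL→EMIL⟨∨cl⟩ : Interpretation (EMIL em X) (EMIL⟨∨cl⟩ em X)
  EMIL→EMIL⟨∨cl⟩ = record
    { atom↦ = atom ; unary↦ = λ () ; binary↦ = λ ()
    ; atom-⇔ = λ _ _ _ → ⇔-id _ ; unary-⇔ = λ () ; binary-⇔ = λ () }

  -- Independence atoms and classical disjunction in MTL.

  module _ (x : X) where

    type : (F : List (Form (ML X))) → Vec Bool (length F) → Form (ML X)
    type F = hasType x (fromList F)

    clause : ∀ P Q R → Vec Bool (length P) → Vec Bool (length Q) →
             Vec Bool (length R) → Form (MTL X)
    clause P Q R a b c =
      somewhere (type P a ∧ type R c) ⇒ somewhere (type Q b ∧ type R c) ⇒
      somewhere (type P a ∧ type Q b ∧ type R c)

    -- Running over all Boolean vectors is harmless: a type realised nowhere in the team falsifies a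
    -- premise of its clause.
    indep↦ : IndepAtom X → Form (MTL X)
    indep↦ (P ⊥[ R ] Q) = ⋀ λ a → ⋀ λ b → ⋀ λ c → clause P Q R a b c

    type-⇔ : ∀ {M} F v w → Sat M (type F v) w ⇔ typeOf M (fromList F) w ≡ v
    type-⇔ F = hasType-⇔ x (fromList F)

    clause-⇔ : ∀ P Q R a b c {M T} → (M , T ⊨ clause P Q R a b c) ⇔
      (Somewhere M T (type P a ∧ type R c) → Somewhere M T (type Q b ∧ type R c) →
       Somewhere M T (type P a ∧ type Q b ∧ type R c))
    clause-⇔ P Q R a b c = somewhere-⇒-⇔
      (type P a ∧ type R c) (type Q b ∧ type R c) (type P a ∧ type Q b ∧ type R c)

    indep-⇔ : ∀ a M T → ⟦ em ⟧indep a M T ⇔ (M , T ⊨ indep↦ a)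
    indep-⇔ (P ⊥[ R ] Q) M T = mk⇔
      (λ s → from (⋀-⇔ _) λ a → from (⋀-⇔ _) λ b → from (⋀-⇔ _) λ c → forward s a b c)
      (λ s → backward (λ a b c → to (⋀-⇔ _) (to (⋀-⇔ _) (to (⋀-⇔ _) s a) b) c))
      where
      forward : ⟦ em ⟧indep (P ⊥[ R ] Q) M T → ∀ a b c → M , T ⊨ clause P Q R a b c
      forward (lift indep) a b c = from (clause-⇔ P Q R a b c)
        λ (w , w∈T , p , r) (w′ , w′∈T , q , r′) →
          let w″ , w″∈T , w″~w , w″~w′ , w″≈w = indep w∈T w′∈T
                (from (Agree-fromList R)
                  (trans (to (type-⇔ R c w) r) (sym (to (type-⇔ R c w′) r′))))
          in w″ , w″∈T ,
             from (type-⇔ P a w″)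
               (trans (to (Agree-fromList P) w″~w) (to (type-⇔ P a w) p)) ,
             from (type-⇔ Q b w″)
               (trans (to (Agree-fromList Q) w″~w′) (to (type-⇔ Q b w′) q)) ,
             from (type-⇔ R c w″)
               (trans (to (Agree-fromList R) w″≈w) (to (type-⇔ R c w) r))

      backward : (∀ a b c → M , T ⊨ clause P Q R a b c) → ⟦ em ⟧indep (P ⊥[ R ] Q) M T
      backward s = lift λ {w} {w′} w∈T w′∈T w~w′ →
        -- The clause for the types of the given worlds suffices; `c` is also the type of `w′`,
        -- because `w` and `w′` agree on `R`.
        let a = typeOf M (fromList P) w
            b = typeOf M (fromList Q) w′
            c = typeOf M (fromList R) w
            w″ , w″∈T , p , q , r = to (clause-⇔ P Q R a b c) (s a b c)
              (w , w∈T , from (type-⇔ P a w) refl , from (type-⇔ R c w) refl)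
              (w′ , w′∈T , from (type-⇔ Q b w′) refl ,
                from (type-⇔ R c w′) (sym (to (Agree-fromList R) w~w′)))
        in w″ , w″∈T , from (Agree-fromList P) (to (type-⇔ P a w″) p) ,
             from (Agree-fromList Q) (to (type-⇔ Q b w″) q) ,
             from (Agree-fromList R) (to (type-⇔ R c w″) r)

    EMIL⟨∨cl⟩→MTL : Interpretation (EMIL⟨∨cl⟩ em X) (MTL X)
    EMIL⟨∨cl⟩→MTL = record
      { atom↦ = indep↦ ; unary↦ = λ ()
      -- Again `∨` would split the team; classically, `∼ φ ⇒ ψ` says that the whole team satisfies
      -- one of the two.
      ; binary↦ = λ _ φ ψ → ∼ φ ⇒ ψ
      ; atom-⇔ = indep-⇔ ; unary-⇔ = λ ()
      ; binary-⇔ = λ _ {φ = φ} {ψ = ψ} eφ eψ T → mk⇔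
          (λ { (inj₁ s) → from (⇒-⇔ (∼ φ) ψ) (λ n → contradiction (to (eφ T) s) n)
             ; (inj₂ s) → from (⇒-⇔ (∼ φ) ψ) (λ _ → to (eψ T) s) })
          (λ s → decidable-stable em (λ n →
            n (inj₂ (from (eψ T) (to (⇒-⇔ (∼ φ) ψ) s (λ t → n (inj₁ (from (eφ T) t))))))))
      }

    -- Separation of EMDL from EMIL.

    p⊥◇p : Form (EMIL em X)
    -- `X` may have a single variable, so a modal formula supplies the second truth value.
    p⊥◇p = atom ((var x ∷ []) ⊥[ [] ] (◇ (var x) ∷ []))

    -- At the world (a , b), the truth value of p is a and that of ◇p is b.
    square : Kripke X
    square = record
      { W = Bool × Bool
      ; R = λ (_ , b) (a′ , _) → b ≡ a′
      ; π = λ _ (a , _) → a ≡ true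
      ; nonempty = true , true
      }

    value-p : ∀ a b → value em square (var x) (a , b) ≡ a
    value-p true  b = from (value-⇔ {square} (var x) (true , b) true) refl
    value-p false b = from (value-⇔ {square} (var x) (false , b) false) (λ ())

    -- The successors of `(a , b)` are exactly the worlds with first coordinate `b`.
    value-◇p : ∀ a b → value em square (◇ (var x)) (a , b) ≡ b
    value-◇p a true  = from (value-⇔ {square} (◇ (var x)) (a , true) true) ((true , true) , refl , refl)
    value-◇p a false = from (value-⇔ {square} (◇ (var x)) (a , false) false) (λ { refl () })

    fullSquare diagonal : TeamModel X
    fullSquare = record { model = square ; team = U ; team-nonempty = (true , true) , tt }
    diagonal = record
      { model = square ; team = λ (a , b) → a ≡ b ; team-nonempty = (true , true) , refl }

    fullSquare⊨p⊥◇p : fullSquare ∈ Defines p⊥◇p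
    -- The witness takes `p` from the first world and `◇p` from the second.
    fullSquare⊨p⊥◇p = lift λ { {a , b} {a′ , b′} _ _ _ → (a , b′) , tt ,
      trans (value-p a b′) (sym (value-p a b)) ∷ [] ,
      trans (value-◇p a b′) (sym (value-◇p a′ b′)) ∷ [] , [] }

    -- The worlds `(true , true)` and `(false , false)` would call for `(true , false)`, which is
    -- off the diagonal.
    diagonal⊭p⊥◇p : ¬ diagonal ∈ Defines p⊥◇p
    diagonal⊭p⊥◇p (lift indep)
      with indep {true , true} {false , false} refl refl []
    ... | (a , .a) , refl , e ∷ [] , e′ ∷ [] , _
      with trans (sym (value-p a a)) (trans e (value-p true true))
         | trans (sym (value-◇p a a)) (trans e′ (value-◇p false false))
    ... | refl | ()

    -- The Boolean function that works for a team works for each subteam.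
    EMDL-downwardClosed : ∀ M (φ : Form (EMDL em X)) →
                          RestrictsTo M (λ _ → ⊤) (λ T → M , T ⊨ φ)
    EMDL-downwardClosed M = ⊨-restricts M (λ _ → ⊤) (λ _ _ → tt) (λ _ → tt)
      (λ { (dep _ _) _ S⊆T (lift (f , d)) → lift (f , λ w∈S → d (S⊆T w∈S)) })
      (λ ()) (λ ())

    p⊥◇p∉EMDL : ¬ Expressible (EMDL em X) (Defines p⊥◇p)
    p⊥◇p∉EMDL (φ , ⊆φ , φ⊆) = diagonal⊭p⊥◇p (φ⊆ {diagonal}
      (EMDL-downwardClosed square φ tt (λ _ → tt) (⊆φ {fullSquare} fullSquare⊨p⊥◇p)))

    -- Separation of EMIL with classical disjunction from MTL.

    edgeless : Kripke X
    edgeless = record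
      { W = Bool ; R = λ _ _ → ⊥ ; π = λ _ a → a ≡ true ; nonempty = true }

    AtMostOne : Team edgeless → Set
    AtMostOne T = ∀ {w w′} → w ∈ T → w′ ∈ T → w ≡ w′

    -- A team with at most one world satisfies every independence atom, its world being its own
    -- witness. Without edges all images are empty, so the size bound survives `◇` and `□`.
    EMIL⟨∨cl⟩-restricts : ∀ (φ : Form (EMIL⟨∨cl⟩ em X)) →
                          RestrictsTo edgeless AtMostOne (λ T → edgeless , T ⊨ φ)
    EMIL⟨∨cl⟩-restricts = ⊨-restricts edgeless AtMostOne
      (λ S⊆T one w∈S w′∈S → one (S⊆T w∈S) (S⊆T w′∈S))
      (λ _ ())
      (λ { (P ⊥[ R ] Q) one _ _ → lift λ {w} w∈S w′∈S _ →
           w , w∈S , Agree-≡ P refl , Agree-≡ Q (one w∈S w′∈S) , Agree-≡ R refl })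
      (λ ())
      (λ _ restrictsP restrictsQ one S⊆T →
        Sum.map (restrictsP one S⊆T) (restrictsQ one S⊆T))
      where
      Agree-≡ : ∀ F {w w′} → w ≡ w′ → Agree em edgeless F w w′
      Agree-≡ F refl = All.universal (λ _ → refl) F

    somewhere-p : Form (MTL X)
    somewhere-p = somewhere (var x)

    bothWorlds falseWorld : TeamModel X
    bothWorlds = record { model = edgeless ; team = U ; team-nonempty = true , tt }
    falseWorld = record { model = edgeless ; team = ｛ false ｝ ; team-nonempty = false , refl }

    -- Passing from both worlds to the singleton of `false` keeps every formula of the weaker logic
    -- but loses the only world where `p` holds.
    somewhere-p∉EMIL⟨∨cl⟩ : ¬ Expressible (EMIL⟨∨cl⟩ em X) (Defines somewhere-p)
    somewhere-p∉EMIL⟨∨cl⟩ (φ , ⊆φ , φ⊆)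
      with to (somewhere-⇔ {edgeless} (var x)) (φ⊆ {falseWorld}
             (EMIL⟨∨cl⟩-restricts φ (λ { refl refl → refl }) (λ _ → tt)
               (⊆φ {bothWorlds} (from (somewhere-⇔ {edgeless} (var x)) (true , tt , refl)))))
    ... | _ , refl , ()

theorem4p2 : (em : ExcludedMiddle 1ℓ) (X : Set) (n : ℕ) → X ↔ Fin (suc n) →
    (EMDL em X ≺ EMIL em X) ×
    (EMIL em X ≼ EMIL⟨∨cl⟩ em X) ×
    (EMIL⟨∨cl⟩ em X ≺ MTL X)
theorem4p2 em X n X↔Fin =
  (interpretation⇒≼ (EMDL→EMIL em) ,
    Defines (p⊥◇p em x) , (p⊥◇p em x , id , id) , p⊥◇p∉EMDL em x) ,
  interpretation⇒≼ (EMIL→EMIL⟨∨cl⟩ em) ,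
  (interpretation⇒≼ (EMIL⟨∨cl⟩→MTL em x) ,
    Defines (somewhere-p em x) , (somewhere-p em x , id , id) , somewhere-p∉EMIL⟨∨cl⟩ em x)
  where
  x : X
  -- Nonemptiness of `X` provides the variable for the tautology in `hasType` and for both
  -- separating properties.
  x = Inverse.from X↔Fin zero
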